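{- Every theory $\mathcal T$ of the semi-effect calculus SEC induces a strong equivariant functor: the term-model data $(\mathcal V_{\mathcal T},\mathcal C_{\mathcal T},\cdot,F)$ of $\mathcal T$ form a category $\mathcal V_{\mathcal T}$ with finite products, a $\mathcal V_{\mathcal T}$-actegory $\mathcal C_{\mathcal T}$ (for the cartesian monoidal structure on $\mathcal V_{\mathcal T}$), and a strong $\mathcal V_{\mathcal T}$-equivariant functor $F:\mathcal V_{\mathcal T}\to\mathcal C_{\mathcal T}$.
   Context: **Actegories.** Let $(\mathcal M,\otimes,I)$ be a monoidal category. An $\mathcal M$-action on a category $\mathcal C$ is a bifunctor $(-)\cdot(-):\mathcal M\times\mathcal C\to\mathcal C$ with natural isomorphisms $\eta_c:I\cdot c\to c$ and $\mu_{m_1,m_2,c}:(m_1\otimes m_2)\cdot c\to m_1\cdot(m_2\cdot c)$ such that (suppressing associators) $\mu_{m_1,m_2,m_3\cdot c}\circ\mu_{m_1\otimes m_2,m_3,c}=(\mathrm{id}\cdot\mu_{m_2,m_3,c})\circ\mu_{m_1,m_2\otimes m_3,c}$ and $(\mathrm{id}_m\cdot\eta_c)\circ\mu_{m,I,c}=r_m\cdot\mathrm{id}_c$, with $r_m:m\otimes I\to m$ the right unitor. An $\mathcal M$-actegory is a category with an $\mathcal M$-action; $\mathcal M$ acts on itself by $\otimes$. A functor $F:\mathcal C\to\mathcal D$ between $\mathcal M$-actegories is strong $\mathcal M$-equivariant if it is equipped with a natural isomorphism $\phi_{m,c}:m\cdot Fc\to F(m\cdot c)$ such that $F\mu_{m,m',c}\circ\phi_{m\otimes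 m',c}=\phi_{m,m'\cdot c}\circ(\mathrm{id}\cdot\phi_{m',c})\circ\mu_{m,m',Fc}$ and $F\eta_c\circ\phi_{I,c}=\eta_{Fc}$. **Syntax of SEC.** A signature consists of a set of base value types $\sigma$, a set of base computation types $b$, and a set of function symbols. Value types: $\tau::=\sigma\mid\tau\times\tau\mid 1$. Computation types: $A::=b\mid\rhd\tau$. Each function symbol has a sort of one of the forms $f:\tau_1,\dots,\tau_n\to\tau$, $g:\tau_1,\dots,\tau_n,A\to A'$, $h:\tau_1,\dots,\tau_n\to A$. A value context $\Gamma$ is a finite list of distinct typed value variables $x:\tau$; a computation context $\Delta$ is either empty (written $\cdot$) or a single typed computation variable $v:A$. Judgments are $\Gamma\vdash_v M:\tau$ and $\Gamma\mid\Delta\vdash_c N:A$, generated as follows. - Value terms: $\Gamma\vdash_v x:\tau$ if $(x:\tau)\in\Gamma$; if $\Gamma\vdash_v M_i:\tau_i$ for all $i$ then $\Gamma\vdash_v f(M_1,\dots,M_n):\tau$; plus the usual rules for pairing $\langle M,M'\rangle$, projections $\pi_1M,\pi_2M$ and the unit term for $\times,1$. - $\Gamma\mid v:A\vdash_c v:A$. - If $\Gamma\vdash_v M_i:\tau_i$ for all $i$ and $\Gamma\mid\Delta\vdash_c N:A$, then $\Gamma\mid\Delta\vdash_c g(M_1,\dots,M_n,N):A'$. - If $\Gamma\vdash_v M_i:\tau_i$ for all $i$, then $\Gamma\mid\cdot\vdash_c h(M_1,\dots,M_n):A$. - If $\Gamma\vdash_v M:\tau$ then $\Gamma\mid\cdot\vdash_c\mathtt{val}\,M:\rhd\tau$.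 - If $\Gamma\mid\Delta\vdash_c N_1:\rhd\tau$ and $x:\tau,\Gamma\mid\cdot\vdash_c N_2:A$, then $\Gamma\mid\Delta\vdash_c(\mathtt{let\ val}\ x=N_1\ \mathtt{in}\ N_2):A$. **Theories and derivability.** An equation-in-context relates two terms of the same type in the same context. A theory is a signature together with a set of equations-in-context (axioms). The derivable equations are those generated by the axioms, congruence, reflexivity, symmetry, transitivity, substitution (of value terms for value variables and of computation terms for the computation variable), the usual $\beta\eta$-laws of finite products for value terms, and: - ($\beta$) $\Gamma\mid\cdot\vdash_c(\mathtt{let\ val}\ x=\mathtt{val}\,M\ \mathtt{in}\ N)=_A N[M/x]$ whenever $\Gamma\vdash_v M:\tau$ and $x:\tau,\Gamma\mid\cdot\vdash_c N:A$; - ($\eta$) $\Gamma\mid\Delta\vdash_c(\mathtt{let\ val}\ x=N\ \mathtt{in}\ \mathtt{val}\,x)=_{\rhd\tau}N$ whenever $\Gamma\mid\Delta\vdash_c N:\rhd\tau$; - (commuting conversion) $\Gamma\mid\Delta\vdash_c(\mathtt{let\ val}\ x=N_1\ \mathtt{in}\ K[N_2/v])=_{A'}K[(\mathtt{let\ val}\ x=N_1\ \mathtt{in}\ N_2)/v]$ whenever $\Gamma\mid\Delta\vdash_c N_1:\rhd\tau$, $x:\tau,\Gamma\mid\cdot\vdash_c N_2:A$ and $\Gamma\mid v:A\vdash_c K:A'$. **Term model.** Write $[\,\cdot\,]$ for the equivalence class of a typed term-in-context up to renaming of variables and derivable equality in $\mathcal T$. - $\mathcal V_{\mathcal T}$: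 objects are value types; morphisms $\tau_1\to\tau_2$ are classes $[x:\tau_1\vdash_v M:\tau_2]$; identities are variables; composition is substitution. Binary products are $\tau_1\times\tau_2$, the terminal object is $1$. - $\mathcal C_{\mathcal T}$: objects are pairs $(\tau\mid A)$ of a value type and a computation type, and objects $(\tau\mid\cdot)$ for value types $\tau$. A morphism $(\tau\mid\Delta)\to(\tau'\mid A')$ ($\Delta$ empty or a computation type) is a pair $([x:\tau\vdash_v M':\tau'],[x:\tau\mid\Delta\vdash_c N:A'])$; a morphism $(\tau\mid\cdot)\to(\tau'\mid\cdot)$ is a class $[x:\tau\vdash_v M':\tau']$; there are no morphisms $(\tau\mid A)\to(\tau'\mid\cdot)$. Identities are given by variables. Composition is by substitution: value components compose as in $\mathcal V_{\mathcal T}$, and the computation component of a composite is $N''[M'/x']$ when the middle object is $(\tau'\mid\cdot)$ and the first morphism is $[M']$, and $N''[M'/x',N'/v']$ when the middle object is $(\tau'\mid A')$ and the first morphism is $([M'],[N'])$. - Action: $\tau\cdot(\tau'\mid\Delta)=(\tau\times\tau'\mid\Delta)$; on morphisms, $[x:\tau_1\vdash_v M:\tau_2]\cdot([x':\tau_3\vdash_v M':\tau_4],[y:\tau_3\mid\Delta\vdash_c N:A])=([z:\tau_1\times\tau_3\vdash_v\langle M[\pi_1z/x],M'[\pi_2z/x']\rangle:\tau_2\times\tau_4],[w:\tau_1\times\tau_3\mid\Delta\vdash_c N[\pi_2w/y]:A])$, and by the first component alone for morphisms $(\tau_3\mid\cdot)\to(\tau_4\mid\cdot)$. The isomorphisms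 $\eta$ and $\mu$ have as value components the second projection $1\times\tau\to\tau$ and the associativity map $(\tau\times\tau')\times\tau''\to\tau\times(\tau'\times\tau'')$, and, when the computation part is $A$, the computation variable $v:A$ as computation component. - $F(\tau)=(\tau\mid\cdot)$, $F$ is the identity on morphisms, and $\phi:\tau\cdot F\tau'\to F(\tau\times\tau')$ is the identity. -}

module Defs where

open import Level using (Level; suc; _⊔_)
open import Data.List.Base using (List; []; _∷_)
open import Data.List.Membership.Propositional using (_∈_)
open import Data.List.Relation.Binary.Subset.Propositional using (_⊆_)
open import Data.List.Relation.Unary.All as All using (All; []; _∷_)
open import Data.List.Relation.Unary.Any using (here; there)
open import Data.Maybe.Base using (Maybe; just; nothing)
open import Data.Product.Base using (_×_; _,_; proj₁; proj₂)
open import Relation.Binary.Core using (Rel)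
open import Relation.Binary.PropositionalEquality.Core using (refl)
open import Relation.Binary.Structures using (IsEquivalence)

private
  variable
    o h e o′ h′ e′ o″ h″ e″ ℓ : Level

-- Categories have hom-setoids: "equal morphisms" always means _≈_.  As with the
-- raw bundles of Algebra.Bundles.Raw, operations are separated from their laws.

record RawCategory (o h e : Level) : Set (suc (o ⊔ h ⊔ e)) where
  infix  4 _⇒_ _≈_
  infixr 9 _∘_
  field
    Obj : Set o
    _⇒_ : Obj → Obj → Set h
    _≈_ : ∀ {A B} → Rel (A ⇒ B) e
    id  : ∀ {A} → A ⇒ A
    _∘_ : ∀ {A B C} → B ⇒ C → A ⇒ B → A ⇒ C

record IsCategory (C : RawCategory o h e) : Set (o ⊔ h ⊔ e) where
  open RawCategory C
  field
    isEquivalence : ∀ {A B} → IsEquivalence (_≈_ {A} {B})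
    ∘-resp-≈      : ∀ {A B C} {f f′ : B ⇒ C} {g g′ : A ⇒ B} →
                    f ≈ f′ → g ≈ g′ → f ∘ g ≈ f′ ∘ g′
    identityˡ     : ∀ {A B} (f : A ⇒ B) → id ∘ f ≈ f
    identityʳ     : ∀ {A B} (f : A ⇒ B) → f ∘ id ≈ f
    assoc         : ∀ {A B C D} (f : C ⇒ D) (g : B ⇒ C) (k : A ⇒ B) →
                    (f ∘ g) ∘ k ≈ f ∘ (g ∘ k)

module _ (C : RawCategory o h e) where
  open RawCategory C

  record IsIso {A B : Obj} (f : A ⇒ B) : Set (h ⊔ e) where
    field
      inverse : B ⇒ A
      isoˡ    : inverse ∘ f ≈ id
      isoʳ    : f ∘ inverse ≈ id

infixr 2 _×ᶜ_
_×ᶜ_ : RawCategory o h e → RawCategory o′ h′ e′ →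
       RawCategory (o ⊔ o′) (h ⊔ h′) (e ⊔ e′)
C ×ᶜ D = record
  { Obj = C.Obj × D.Obj
  ; _⇒_ = λ (A , B) (A′ , B′) → (A C.⇒ A′) × (B D.⇒ B′)
  ; _≈_ = λ (f , g) (f′ , g′) → (f C.≈ f′) × (g D.≈ g′)
  ; id  = C.id , D.id
  ; _∘_ = λ (f , g) (f′ , g′) → f C.∘ f′ , g D.∘ g′
  }
  where
    module C = RawCategory C
    module D = RawCategory D

record RawFunctor (C : RawCategory o h e) (D : RawCategory o′ h′ e′) :
                  Set (o ⊔ h ⊔ o′ ⊔ h′) where
  private
    module C = RawCategory C
    module D = RawCategory D
  field
    F₀ : C.Obj → D.Obj
    F₁ : ∀ {A B} → A C.⇒ B → F₀ A D.⇒ F₀ B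

record IsFunctor {C : RawCategory o h e} {D : RawCategory o′ h′ e′}
                 (F : RawFunctor C D) : Set (o ⊔ h ⊔ e ⊔ e′) where
  open RawFunctor F
  private
    module C = RawCategory C
    module D = RawCategory D
  field
    F-resp-≈     : ∀ {A B} {f g : A C.⇒ B} → f C.≈ g → F₁ f D.≈ F₁ g
    identity     : ∀ {A} → F₁ (C.id {A}) D.≈ D.id
    homomorphism : ∀ {A B E} (f : B C.⇒ E) (g : A C.⇒ B) →
                   F₁ (f C.∘ g) D.≈ F₁ f D.∘ F₁ g

record RawFiniteProducts (C : RawCategory o h e) : Set (o ⊔ h) where
  open RawCategory C
  infixr 7 _×₀_
  field
    ⊤     : Obj
    !     : ∀ {A} → A ⇒ ⊤
    _×₀_  : Obj → Obj → Obj
    π₁    : ∀ {A B} → A ×₀ B ⇒ A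
    π₂    : ∀ {A B} → A ×₀ B ⇒ B
    ⟨_,_⟩ : ∀ {X A B} → X ⇒ A → X ⇒ B → X ⇒ A ×₀ B

record IsCartesianCategory {C : RawCategory o h e} (P : RawFiniteProducts C) :
                           Set (o ⊔ h ⊔ e) where
  open RawCategory C
  open RawFiniteProducts P
  field
    isCategory : IsCategory C
    !-unique   : ∀ {A} (f : A ⇒ ⊤) → ! ≈ f
    project₁   : ∀ {X A B} (f : X ⇒ A) (g : X ⇒ B) → π₁ ∘ ⟨ f , g ⟩ ≈ f
    project₂   : ∀ {X A B} (f : X ⇒ A) (g : X ⇒ B) → π₂ ∘ ⟨ f , g ⟩ ≈ g
    unique     : ∀ {X A B} {f : X ⇒ A} {g : X ⇒ B} (k : X ⇒ A ×₀ B) →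
                 π₁ ∘ k ≈ f → π₂ ∘ k ≈ g → ⟨ f , g ⟩ ≈ k

record RawMonoidal (M : RawCategory o h e) : Set (o ⊔ h) where
  open RawCategory M
  infixr 10 _⊗₀_ _⊗₁_
  field
    ⊗    : RawFunctor (M ×ᶜ M) M
    unit : Obj

  _⊗₀_ : Obj → Obj → Obj
  A ⊗₀ B = RawFunctor.F₀ ⊗ (A , B)

  _⊗₁_ : ∀ {A B A′ B′} → A ⇒ A′ → B ⇒ B′ → A ⊗₀ B ⇒ A′ ⊗₀ B′
  f ⊗₁ g = RawFunctor.F₁ ⊗ (f , g)

  field
    α : ∀ A B C → (A ⊗₀ B) ⊗₀ C ⇒ A ⊗₀ (B ⊗₀ C)
    l : ∀ A → unit ⊗₀ A ⇒ A
    r : ∀ A → A ⊗₀ unit ⇒ A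

record IsMonoidalCategory {M : RawCategory o h e} (𝓜 : RawMonoidal M) :
                          Set (o ⊔ h ⊔ e) where
  open RawCategory M
  open RawMonoidal 𝓜
  field
    isCategory  : IsCategory M
    ⊗-isFunctor : IsFunctor ⊗
    α-natural   : ∀ {A A′ B B′ C C′} (f : A ⇒ A′) (g : B ⇒ B′) (k : C ⇒ C′) →
                  α A′ B′ C′ ∘ (f ⊗₁ g) ⊗₁ k ≈ f ⊗₁ (g ⊗₁ k) ∘ α A B C
    l-natural   : ∀ {A A′} (f : A ⇒ A′) → l A′ ∘ id ⊗₁ f ≈ f ∘ l A
    r-natural   : ∀ {A A′} (f : A ⇒ A′) → r A′ ∘ f ⊗₁ id ≈ f ∘ r A
    α-isIso     : ∀ A B C → IsIso M (α A B C)
    l-isIso     : ∀ A → IsIso M (l A)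
    r-isIso     : ∀ A → IsIso M (r A)
    pentagon    : ∀ A B C D →
                  α A B (C ⊗₀ D) ∘ α (A ⊗₀ B) C D
                    ≈ id ⊗₁ α B C D ∘ α A (B ⊗₀ C) D ∘ α A B C ⊗₁ id
    triangle    : ∀ A B → id ⊗₁ l B ∘ α A unit B ≈ r A ⊗₁ id

cartesianMonoidal : {C : RawCategory o h e} → RawFiniteProducts C → RawMonoidal C
cartesianMonoidal {C = C} P = record
  { ⊗    = record
    { F₀ = λ (A , B) → A ×₀ B
    ; F₁ = λ (f , g) → ⟨ f ∘ π₁ , g ∘ π₂ ⟩
    }
  ; unit = ⊤
  ; α    = λ _ _ _ → ⟨ π₁ ∘ π₁ , ⟨ π₂ ∘ π₁ , π₂ ⟩ ⟩
  ; l    = λ _ → π₂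
  ; r    = λ _ → π₁
  }
  where
    open RawCategory C
    open RawFiniteProducts P

record RawAction {M : RawCategory o h e} (𝓜 : RawMonoidal M)
                 (C : RawCategory o′ h′ e′) : Set (o ⊔ h ⊔ o′ ⊔ h′) where
  private
    module M = RawCategory M
  open RawMonoidal 𝓜
  open RawCategory C
  infixr 10 _·₀_ _·₁_
  field
    act : RawFunctor (M ×ᶜ C) C

  _·₀_ : M.Obj → Obj → Obj
  m ·₀ c = RawFunctor.F₀ act (m , c)

  _·₁_ : ∀ {m m′ c c′} → m M.⇒ m′ → c ⇒ c′ → m ·₀ c ⇒ m′ ·₀ c′
  f ·₁ g = RawFunctor.F₁ act (f , g)

  field
    η : ∀ c → unit ·₀ c ⇒ c
    μ : ∀ m₁ m₂ c → (m₁ ⊗₀ m₂) ·₀ c ⇒ m₁ ·₀ (m₂ ·₀ c)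

-- The coherence law for μ carries the associator explicitly.
record IsActegory {M : RawCategory o h e} {𝓜 : RawMonoidal M}
                  {C : RawCategory o′ h′ e′} (𝓐 : RawAction 𝓜 C) :
                  Set (o ⊔ h ⊔ e ⊔ o′ ⊔ h′ ⊔ e′) where
  private
    module M = RawCategory M
  open RawMonoidal 𝓜
  open RawCategory C
  open RawAction 𝓐
  field
    isCategory    : IsCategory C
    act-isFunctor : IsFunctor act
    η-natural     : ∀ {c c′} (f : c ⇒ c′) → η c′ ∘ M.id ·₁ f ≈ f ∘ η c
    μ-natural     : ∀ {m₁ m₁′ m₂ m₂′ c c′}
                    (f₁ : m₁ M.⇒ m₁′) (f₂ : m₂ M.⇒ m₂′) (g : c ⇒ c′) →
                    μ m₁′ m₂′ c′ ∘ (f₁ ⊗₁ f₂) ·₁ g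
                      ≈ f₁ ·₁ (f₂ ·₁ g) ∘ μ m₁ m₂ c
    η-isIso       : ∀ c → IsIso C (η c)
    μ-isIso       : ∀ m₁ m₂ c → IsIso C (μ m₁ m₂ c)
    μ-assoc       : ∀ m₁ m₂ m₃ c →
                    μ m₁ m₂ (m₃ ·₀ c) ∘ μ (m₁ ⊗₀ m₂) m₃ c
                      ≈ M.id ·₁ μ m₂ m₃ c ∘ μ m₁ (m₂ ⊗₀ m₃) c ∘ α m₁ m₂ m₃ ·₁ id
    μ-unit        : ∀ m c → M.id ·₁ η c ∘ μ m unit c ≈ r m ·₁ id

selfAction : {M : RawCategory o h e} (𝓜 : RawMonoidal M) → RawAction 𝓜 M
selfAction 𝓜 = record { act = ⊗ ; η = l ; μ = α }
  where open RawMonoidal 𝓜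

module _ {M : RawCategory o h e} {𝓜 : RawMonoidal M}
         {C : RawCategory o′ h′ e′} {D : RawCategory o″ h″ e″}
         (𝓐 : RawAction 𝓜 C) (𝓑 : RawAction 𝓜 D) where
  private
    module M = RawCategory M
    module C = RawCategory C
    module A = RawAction 𝓐
    module B = RawAction 𝓑
  open RawMonoidal 𝓜
  open RawCategory D

  record RawEquivariantFunctor : Set (o ⊔ h ⊔ o′ ⊔ h′ ⊔ o″ ⊔ h″) where
    field
      functor : RawFunctor C D
    open RawFunctor functor public
    field
      φ : ∀ m c → m B.·₀ F₀ c ⇒ F₀ (m A.·₀ c)

  record IsStrongEquivariant (F : RawEquivariantFunctor) :
                             Set (o ⊔ h ⊔ e ⊔ o′ ⊔ h′ ⊔ e′ ⊔ o″ ⊔ h″ ⊔ e″) where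
    open RawEquivariantFunctor F
    field
      isFunctor : IsFunctor functor
      φ-natural : ∀ {m m′ c c′} (f : m M.⇒ m′) (g : c C.⇒ c′) →
                  φ m′ c′ ∘ f B.·₁ F₁ g ≈ F₁ (f A.·₁ g) ∘ φ m c
      φ-isIso   : ∀ m c → IsIso D (φ m c)
      φ-μ       : ∀ m m′ c →
                  F₁ (A.μ m m′ c) ∘ φ (m ⊗₀ m′) c
                    ≈ φ m (m′ A.·₀ c) ∘ M.id B.·₁ φ m′ c ∘ B.μ m m′ (F₀ c)
      φ-η       : ∀ c → F₁ (A.η c) ∘ φ unit c ≈ B.η (F₀ c)

infixr 7 _⊠_
data ValueType (V : Set ℓ) : Set ℓ where
  base : V → ValueType V
  _⊠_  : ValueType V → ValueType V → ValueType V
  𝟙    : ValueType V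

data CompType (V C : Set ℓ) : Set ℓ where
  base : C → CompType V C
  ▷_   : ValueType V → CompType V C

data Sort (V C : Set ℓ) : Set ℓ where
  fun  : List (ValueType V) → ValueType V → Sort V C
  comp : List (ValueType V) → CompType V C → CompType V C → Sort V C
  gen  : List (ValueType V) → CompType V C → Sort V C

-- The set of all function symbols is Σ (Sort _ _) Symbol.
record Signature (ℓ : Level) : Set (suc ℓ) where
  field
    ValueBase : Set ℓ
    CompBase  : Set ℓ
    Symbol    : Sort ValueBase CompBase → Set ℓ

-- Terms are intrinsically typed with de Bruijn indices, so that renaming of
-- bound and context variables is absorbed in the syntax.
module Syntax (S : Signature ℓ) where
  open Signature S

  VTy CTy VCtx CCtx : Set ℓ
  VTy  = ValueType ValueBase
  CTy  = CompType ValueBase CompBase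
  VCtx = List VTy
  CCtx = Maybe CTy

  private
    variable
      τ τ′ : VTy
      τs   : List VTy
      A A′ : CTy
      Γ Γ′ : VCtx
      Δ    : CCtx

  infix 4 _⊢ᵛ_ _∣_⊢ᶜ_

  data _⊢ᵛ_ (Γ : VCtx) : VTy → Set ℓ where
    var   : τ ∈ Γ → Γ ⊢ᵛ τ
    fun   : Symbol (fun τs τ) → All (Γ ⊢ᵛ_) τs → Γ ⊢ᵛ τ
    ⟨_,_⟩ : Γ ⊢ᵛ τ → Γ ⊢ᵛ τ′ → Γ ⊢ᵛ τ ⊠ τ′
    π₁    : Γ ⊢ᵛ τ ⊠ τ′ → Γ ⊢ᵛ τ
    π₂    : Γ ⊢ᵛ τ ⊠ τ′ → Γ ⊢ᵛ τ′
    ⋆     : Γ ⊢ᵛ 𝟙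

  data _∣_⊢ᶜ_ (Γ : VCtx) : CCtx → CTy → Set ℓ where
    cvar   : Γ ∣ just A ⊢ᶜ A
    comp   : Symbol (comp τs A A′) → All (Γ ⊢ᵛ_) τs → Γ ∣ Δ ⊢ᶜ A → Γ ∣ Δ ⊢ᶜ A′
    gen    : Symbol (gen τs A) → All (Γ ⊢ᵛ_) τs → Γ ∣ nothing ⊢ᶜ A
    val    : Γ ⊢ᵛ τ → Γ ∣ nothing ⊢ᶜ ▷ τ
    letval : Γ ∣ Δ ⊢ᶜ ▷ τ → τ ∷ Γ ∣ nothing ⊢ᶜ A → Γ ∣ Δ ⊢ᶜ A

  mutual
    rename : Γ ⊆ Γ′ → Γ ⊢ᵛ τ → Γ′ ⊢ᵛ τ
    rename ρ (var x)    = var (ρ x)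
    rename ρ (fun f Ms) = fun f (rename* ρ Ms)
    rename ρ ⟨ M , N ⟩  = ⟨ rename ρ M , rename ρ N ⟩
    rename ρ (π₁ M)     = π₁ (rename ρ M)
    rename ρ (π₂ M)     = π₂ (rename ρ M)
    rename ρ ⋆          = ⋆

    rename* : Γ ⊆ Γ′ → All (Γ ⊢ᵛ_) τs → All (Γ′ ⊢ᵛ_) τs
    rename* ρ []       = []
    rename* ρ (M ∷ Ms) = rename ρ M ∷ rename* ρ Ms

  Sub : VCtx → VCtx → Set ℓ
  Sub Γ′ Γ = All (Γ′ ⊢ᵛ_) Γ

  ids : Sub Γ Γ
  ids = All.tabulate var

  weaken : Sub Γ′ Γ → Sub (τ ∷ Γ′) Γ
  weaken = rename* there

  lift : Sub Γ′ Γ → Sub (τ ∷ Γ′) (τ ∷ Γ)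
  lift σ = var (here refl) ∷ weaken σ

  infixl 8 _[_]ᵛ _[_]* _[_]ᶜ _⟪_⟫

  mutual
    _[_]ᵛ : Γ ⊢ᵛ τ → Sub Γ′ Γ → Γ′ ⊢ᵛ τ
    var x     [ σ ]ᵛ = All.lookup σ x
    fun f Ms  [ σ ]ᵛ = fun f (Ms [ σ ]*)
    ⟨ M , N ⟩ [ σ ]ᵛ = ⟨ M [ σ ]ᵛ , N [ σ ]ᵛ ⟩
    π₁ M      [ σ ]ᵛ = π₁ (M [ σ ]ᵛ)
    π₂ M      [ σ ]ᵛ = π₂ (M [ σ ]ᵛ)
    ⋆         [ σ ]ᵛ = ⋆

    _[_]* : All (Γ ⊢ᵛ_) τs → Sub Γ′ Γ → All (Γ′ ⊢ᵛ_) τs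
    []       [ σ ]* = []
    (M ∷ Ms) [ σ ]* = M [ σ ]ᵛ ∷ Ms [ σ ]*

  _[_]ᶜ : Γ ∣ Δ ⊢ᶜ A → Sub Γ′ Γ → Γ′ ∣ Δ ⊢ᶜ A
  cvar        [ σ ]ᶜ = cvar
  comp g Ms N [ σ ]ᶜ = comp g (Ms [ σ ]*) (N [ σ ]ᶜ)
  gen k Ms    [ σ ]ᶜ = gen k (Ms [ σ ]*)
  val M       [ σ ]ᶜ = val (M [ σ ]ᵛ)
  letval N N′ [ σ ]ᶜ = letval (N [ σ ]ᶜ) (N′ [ lift σ ]ᶜ)

  -- K ⟪ N ⟫ is K[N/v]; the body of letval has no computation variable.
  _⟪_⟫ : Γ ∣ just A ⊢ᶜ A′ → Γ ∣ Δ ⊢ᶜ A → Γ ∣ Δ ⊢ᶜ A′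
  cvar        ⟪ N ⟫ = N
  comp g Ms K ⟪ N ⟫ = comp g Ms (K ⟪ N ⟫)
  letval K N′ ⟪ N ⟫ = letval (K ⟪ N ⟫) N′

record Theory (ℓ : Level) : Set (suc ℓ) where
  field
    signature : Signature ℓ
  open Syntax signature
  field
    Axiomᵛ : ∀ {Γ τ} → Rel (Γ ⊢ᵛ τ) ℓ
    Axiomᶜ : ∀ {Γ Δ A} → Rel (Γ ∣ Δ ⊢ᶜ A) ℓ

module Derivability (𝓣 : Theory ℓ) where
  open Theory 𝓣
  open Signature signature
  open Syntax signature

  private
    variable
      τ τ′ : VTy
      τs   : List VTy
      A A′ : CTy
      Γ Γ′ : VCtx
      Δ    : CCtx

  infix 4 _≈ᵛ_ _≈*_ _≈ᶜ_

  mutual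
    data _≈ᵛ_ : Γ ⊢ᵛ τ → Γ ⊢ᵛ τ → Set ℓ where
      axiom   : {M M′ : Γ ⊢ᵛ τ} → Axiomᵛ M M′ → M ≈ᵛ M′

      ≈-refl  : {M : Γ ⊢ᵛ τ} → M ≈ᵛ M
      ≈-sym   : {M M′ : Γ ⊢ᵛ τ} → M ≈ᵛ M′ → M′ ≈ᵛ M
      ≈-trans : {M M′ M″ : Γ ⊢ᵛ τ} → M ≈ᵛ M′ → M′ ≈ᵛ M″ → M ≈ᵛ M″

      fun-cong  : (f : Symbol (fun τs τ)) {Ms Ms′ : All (Γ ⊢ᵛ_) τs} →
                  Ms ≈* Ms′ → fun f Ms ≈ᵛ fun f Ms′
      pair-cong : {M M′ : Γ ⊢ᵛ τ} {N N′ : Γ ⊢ᵛ τ′} →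
                  M ≈ᵛ M′ → N ≈ᵛ N′ → ⟨ M , N ⟩ ≈ᵛ ⟨ M′ , N′ ⟩
      π₁-cong   : {M M′ : Γ ⊢ᵛ τ ⊠ τ′} → M ≈ᵛ M′ → π₁ M ≈ᵛ π₁ M′
      π₂-cong   : {M M′ : Γ ⊢ᵛ τ ⊠ τ′} → M ≈ᵛ M′ → π₂ M ≈ᵛ π₂ M′

      substitution : {M M′ : Γ ⊢ᵛ τ} (σ : Sub Γ′ Γ) →
                     M ≈ᵛ M′ → M [ σ ]ᵛ ≈ᵛ M′ [ σ ]ᵛ

      π₁-β : (M : Γ ⊢ᵛ τ) (N : Γ ⊢ᵛ τ′) → π₁ ⟨ M , N ⟩ ≈ᵛ M
      π₂-β : (M : Γ ⊢ᵛ τ) (N : Γ ⊢ᵛ τ′) → π₂ ⟨ M , N ⟩ ≈ᵛ N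
      ⊠-η  : (M : Γ ⊢ᵛ τ ⊠ τ′) → ⟨ π₁ M , π₂ M ⟩ ≈ᵛ M
      𝟙-η  : (M : Γ ⊢ᵛ 𝟙) → ⋆ ≈ᵛ M

    data _≈*_ {Γ} : All (Γ ⊢ᵛ_) τs → All (Γ ⊢ᵛ_) τs → Set ℓ where
      []  : [] ≈* []
      _∷_ : {M M′ : Γ ⊢ᵛ τ} {Ms Ms′ : All (Γ ⊢ᵛ_) τs} →
            M ≈ᵛ M′ → Ms ≈* Ms′ → (M ∷ Ms) ≈* (M′ ∷ Ms′)

  data _≈ᶜ_ : Γ ∣ Δ ⊢ᶜ A → Γ ∣ Δ ⊢ᶜ A → Set ℓ where
    axiom   : {N N′ : Γ ∣ Δ ⊢ᶜ A} → Axiomᶜ N N′ → N ≈ᶜ N′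

    ≈-refl  : {N : Γ ∣ Δ ⊢ᶜ A} → N ≈ᶜ N
    ≈-sym   : {N N′ : Γ ∣ Δ ⊢ᶜ A} → N ≈ᶜ N′ → N′ ≈ᶜ N
    ≈-trans : {N N′ N″ : Γ ∣ Δ ⊢ᶜ A} → N ≈ᶜ N′ → N′ ≈ᶜ N″ → N ≈ᶜ N″

    comp-cong   : (g : Symbol (comp τs A A′)) {Ms Ms′ : All (Γ ⊢ᵛ_) τs}
                  {N N′ : Γ ∣ Δ ⊢ᶜ A} →
                  Ms ≈* Ms′ → N ≈ᶜ N′ → comp g Ms N ≈ᶜ comp g Ms′ N′
    gen-cong    : (k : Symbol (gen τs A)) {Ms Ms′ : All (Γ ⊢ᵛ_) τs} →
                  Ms ≈* Ms′ → gen k Ms ≈ᶜ gen k Ms′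
    val-cong    : {M M′ : Γ ⊢ᵛ τ} → M ≈ᵛ M′ → val M ≈ᶜ val M′
    letval-cong : {N₁ N₁′ : Γ ∣ Δ ⊢ᶜ ▷ τ} {N₂ N₂′ : τ ∷ Γ ∣ nothing ⊢ᶜ A} →
                  N₁ ≈ᶜ N₁′ → N₂ ≈ᶜ N₂′ → letval N₁ N₂ ≈ᶜ letval N₁′ N₂′

    substitutionᵛ : {N N′ : Γ ∣ Δ ⊢ᶜ A} (σ : Sub Γ′ Γ) →
                    N ≈ᶜ N′ → N [ σ ]ᶜ ≈ᶜ N′ [ σ ]ᶜ
    substitutionᶜ : {K K′ : Γ ∣ just A ⊢ᶜ A′} (N : Γ ∣ Δ ⊢ᶜ A) →
                    K ≈ᶜ K′ → K ⟪ N ⟫ ≈ᶜ K′ ⟪ N ⟫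

    let-β : (M : Γ ⊢ᵛ τ) (N : τ ∷ Γ ∣ nothing ⊢ᶜ A) →
            letval (val M) N ≈ᶜ N [ M ∷ ids ]ᶜ
    let-η : (N : Γ ∣ Δ ⊢ᶜ ▷ τ) → letval N (val (var (here refl))) ≈ᶜ N
    let-commute : (N₁ : Γ ∣ Δ ⊢ᶜ ▷ τ) (N₂ : τ ∷ Γ ∣ nothing ⊢ᶜ A)
                  (K : Γ ∣ just A ⊢ᶜ A′) →
                  letval N₁ (K [ weaken ids ]ᶜ ⟪ N₂ ⟫) ≈ᶜ K ⟪ letval N₁ N₂ ⟫

module TermModel (𝓣 : Theory ℓ) where
  open Theory 𝓣
  open Syntax signature
  open Derivability 𝓣

  private
    variable
      τ τ′ : VTy
      A    : CTy
      Δ    : CCtx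

  x₀ : τ ∷ [] ⊢ᵛ τ
  x₀ = var (here refl)

  𝒱 : RawCategory ℓ ℓ ℓ
  𝒱 = record
    { Obj = VTy
    ; _⇒_ = λ τ₁ τ₂ → τ₁ ∷ [] ⊢ᵛ τ₂
    ; _≈_ = _≈ᵛ_
    ; id  = x₀
    ; _∘_ = λ M M′ → M [ M′ ∷ [] ]ᵛ
    }

  𝒱-products : RawFiniteProducts 𝒱
  𝒱-products = record
    { ⊤     = 𝟙
    ; !     = ⋆
    ; _×₀_  = _⊠_
    ; π₁    = π₁ x₀
    ; π₂    = π₂ x₀
    ; ⟨_,_⟩ = ⟨_,_⟩
    }

  𝒱-monoidal : RawMonoidal 𝒱
  𝒱-monoidal = cartesianMonoidal 𝒱-products

  CObj : Set ℓ
  CObj = VTy × CCtx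

  -- There are no morphisms (τ , just A) → (τ′ , nothing).
  data CHom : CObj → CObj → Set ℓ where
    pure : τ ∷ [] ⊢ᵛ τ′ → CHom (τ , nothing) (τ′ , nothing)
    _,_  : τ ∷ [] ⊢ᵛ τ′ → τ ∷ [] ∣ Δ ⊢ᶜ A → CHom (τ , Δ) (τ′ , just A)

  data _≈ʰ_ : ∀ {X Y} → CHom X Y → CHom X Y → Set ℓ where
    pure : {M M′ : τ ∷ [] ⊢ᵛ τ′} → M ≈ᵛ M′ → pure M ≈ʰ pure M′
    _,_  : {M M′ : τ ∷ [] ⊢ᵛ τ′} {N N′ : τ ∷ [] ∣ Δ ⊢ᶜ A} →
           M ≈ᵛ M′ → N ≈ᶜ N′ → (M , N) ≈ʰ (M′ , N′)

  -- A value morphism paired with the identity on the computation part.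
  retag : τ ∷ [] ⊢ᵛ τ′ → CHom (τ , Δ) (τ′ , Δ)
  retag {Δ = nothing} M = pure M
  retag {Δ = just A}  M = M , cvar

  idʰ : ∀ {X} → CHom X X
  idʰ = retag x₀

  _∘ʰ_ : ∀ {X Y Z} → CHom Y Z → CHom X Y → CHom X Z
  pure M″    ∘ʰ pure M′   = pure (M″ [ M′ ∷ [] ]ᵛ)
  (M″ , N″)  ∘ʰ pure M′   = M″ [ M′ ∷ [] ]ᵛ , N″ [ M′ ∷ [] ]ᶜ
  (M″ , N″)  ∘ʰ (M′ , N′) = M″ [ M′ ∷ [] ]ᵛ , N″ [ M′ ∷ [] ]ᶜ ⟪ N′ ⟫

  𝒞 : RawCategory ℓ ℓ ℓ
  𝒞 = record
    { Obj = CObj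
    ; _⇒_ = CHom
    ; _≈_ = _≈ʰ_
    ; id  = idʰ
    ; _∘_ = _∘ʰ_
    }

  _·ʰ_ : ∀ {τ₁ τ₂ τ₃ τ₄ Δ Δ′} →
         τ₁ ∷ [] ⊢ᵛ τ₂ → CHom (τ₃ , Δ) (τ₄ , Δ′) → CHom (τ₁ ⊠ τ₃ , Δ) (τ₂ ⊠ τ₄ , Δ′)
  M ·ʰ pure M′  = pure ⟨ M [ π₁ x₀ ∷ [] ]ᵛ , M′ [ π₂ x₀ ∷ [] ]ᵛ ⟩
  M ·ʰ (M′ , N) = ⟨ M [ π₁ x₀ ∷ [] ]ᵛ , M′ [ π₂ x₀ ∷ [] ]ᵛ ⟩ , N [ π₂ x₀ ∷ [] ]ᶜ

  𝒞-action : RawAction 𝒱-monoidal 𝒞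
  𝒞-action = record
    { act = record
      { F₀ = λ (τ , (τ′ , Δ)) → τ ⊠ τ′ , Δ
      ; F₁ = λ (M , k) → M ·ʰ k
      }
    ; η = λ _ → retag (π₂ x₀)
    ; μ = λ _ _ _ → retag ⟨ π₁ (π₁ x₀) , ⟨ π₂ (π₁ x₀) , π₂ x₀ ⟩ ⟩
    }

  F : RawEquivariantFunctor (selfAction 𝒱-monoidal) 𝒞-action
  F = record
    { functor = record
      { F₀ = λ τ → τ , nothing
      ; F₁ = pure
      }
    ; φ = λ _ _ → idʰ
    }

{-# OPTIONS --safe #-}
-- The value part of every coherence law of 𝒞 is the corresponding law of the
-- cartesian monoidal category 𝒱.  All structure maps of 𝒞 are retagged value
-- morphisms, so on the computation part only naturality and functoriality have
-- content, and there they reduce to composing value substitutions followed by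
-- the β-law for the second projection.
module Submission where

open import Level using (Level)
open import Data.List.Base using (List; []; _∷_)
open import Data.List.Membership.Propositional using (_∈_)
open import Data.List.Relation.Binary.Subset.Propositional using (_⊆_)
open import Data.List.Relation.Unary.All as All using (All; []; _∷_)
open import Data.List.Relation.Unary.Any using (here; there)
open import Data.Maybe.Base using (just; nothing)
open import Data.Product.Base using (_×_; _,_)
open import Function.Base using (_∘′_)
open import Relation.Binary.Bundles using (Setoid)
open import Relation.Binary.PropositionalEquality
  using (_≡_; refl; sym; trans; cong; cong₂)
open import Relation.Binary.Structures using (IsEquivalence)
import Relation.Binary.Reasoning.Setoid as SetoidReasoning
open import Defs

private
  variable
    o h e ℓ : Level

-- Equational reasoning in hom-setoids.

module CategoryReasoning {C : RawCategory o h e} (isCategory : IsCategory C) where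
  open RawCategory C
  open IsCategory isCategory

  homSetoid : Obj → Obj → Setoid h e
  homSetoid A B = record { isEquivalence = isEquivalence {A} {B} }

  module _ {A B : Obj} where
    open IsEquivalence (isEquivalence {A} {B}) public
      renaming (refl to ≈-refl; sym to ≈-sym; trans to ≈-trans)
    open SetoidReasoning (homSetoid A B) public

  ∘-congˡ : ∀ {A B D} {f : B ⇒ D} {g g′ : A ⇒ B} → g ≈ g′ → f ∘ g ≈ f ∘ g′
  ∘-congˡ = ∘-resp-≈ ≈-refl

  ∘-congʳ : ∀ {A B D} {f f′ : B ⇒ D} {g : A ⇒ B} → f ≈ f′ → f ∘ g ≈ f′ ∘ g
  ∘-congʳ p = ∘-resp-≈ p ≈-refl

  pullˡ : ∀ {A B D E} {f : D ⇒ E} {g : B ⇒ D} {k : A ⇒ B} {fg : B ⇒ E} →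
          f ∘ g ≈ fg → f ∘ (g ∘ k) ≈ fg ∘ k
  pullˡ p = ≈-trans (≈-sym (assoc _ _ _)) (∘-congʳ p)

-- Coherence of the cartesian monoidal structure.

module CartesianProperties {C : RawCategory o h e} {P : RawFiniteProducts C}
                           (isCartesian : IsCartesianCategory P) where
  open RawCategory C
  open RawFiniteProducts P
  open IsCartesianCategory isCartesian
  open IsCategory isCategory
  open CategoryReasoning isCategory
  open RawMonoidal (cartesianMonoidal P)

  -- By uniqueness: the projections of `⟨ f′ , g′ ⟩` are `f′` and `g′`, hence equal to `f` and `g`.
  ⟨⟩-cong : ∀ {X A B} {f f′ : X ⇒ A} {g g′ : X ⇒ B} →
            f ≈ f′ → g ≈ g′ → ⟨ f , g ⟩ ≈ ⟨ f′ , g′ ⟩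
  ⟨⟩-cong p q = unique _ (≈-trans (project₁ _ _) (≈-sym p))
                         (≈-trans (project₂ _ _) (≈-sym q))

  ⟨⟩-∘ : ∀ {X Y A B} {f : X ⇒ A} {g : X ⇒ B} {k : Y ⇒ X} →
         ⟨ f , g ⟩ ∘ k ≈ ⟨ f ∘ k , g ∘ k ⟩
  ⟨⟩-∘ = ≈-sym (unique _ (pullˡ (project₁ _ _)) (pullˡ (project₂ _ _)))

  ⟨⟩-η : ∀ {X A B} {k : X ⇒ A ×₀ B} → ⟨ π₁ ∘ k , π₂ ∘ k ⟩ ≈ k
  ⟨⟩-η = unique _ ≈-refl ≈-refl

  ⟨π₁,π₂⟩≈id : ∀ {A B} → ⟨ π₁ {A} {B} , π₂ ⟩ ≈ id
  ⟨π₁,π₂⟩≈id = unique id (identityʳ _) (identityʳ _)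

  -- Together with `α-∘-⟨⟩` this serves as a normalisation rule: composites become nested pairings
  -- of composites with projections, and coherence laws can be compared component by component.
  ⊗-∘-⟨⟩ : ∀ {X A A′ B B′} {f : A ⇒ A′} {g : B ⇒ B′} {j : X ⇒ A} {k : X ⇒ B} →
           f ⊗₁ g ∘ ⟨ j , k ⟩ ≈ ⟨ f ∘ j , g ∘ k ⟩
  ⊗-∘-⟨⟩ {f = f} {g} {j} {k} = begin
    ⟨ f ∘ π₁ , g ∘ π₂ ⟩ ∘ ⟨ j , k ⟩
      ≈⟨ ⟨⟩-∘ ⟩
    ⟨ (f ∘ π₁) ∘ ⟨ j , k ⟩ , (g ∘ π₂) ∘ ⟨ j , k ⟩ ⟩
      ≈⟨ ⟨⟩-cong (assoc _ _ _) (assoc _ _ _) ⟩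
    ⟨ f ∘ (π₁ ∘ ⟨ j , k ⟩) , g ∘ (π₂ ∘ ⟨ j , k ⟩) ⟩
      ≈⟨ ⟨⟩-cong (∘-congˡ (project₁ _ _)) (∘-congˡ (project₂ _ _)) ⟩
    ⟨ f ∘ j , g ∘ k ⟩ ∎

  α-∘-⟨⟩ : ∀ {X A B D} {f : X ⇒ A ×₀ B} {g : X ⇒ D} →
           α A B D ∘ ⟨ f , g ⟩ ≈ ⟨ π₁ ∘ f , ⟨ π₂ ∘ f , g ⟩ ⟩
  α-∘-⟨⟩ {f = f} {g} = begin
    ⟨ π₁ ∘ π₁ , ⟨ π₂ ∘ π₁ , π₂ ⟩ ⟩ ∘ ⟨ f , g ⟩
      ≈⟨ ≈-trans ⟨⟩-∘ (⟨⟩-cong ≈-refl ⟨⟩-∘) ⟩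
    ⟨ (π₁ ∘ π₁) ∘ ⟨ f , g ⟩ , ⟨ (π₂ ∘ π₁) ∘ ⟨ f , g ⟩ , π₂ ∘ ⟨ f , g ⟩ ⟩ ⟩
      ≈⟨ ⟨⟩-cong reduce (⟨⟩-cong reduce (project₂ _ _)) ⟩
    ⟨ π₁ ∘ f , ⟨ π₂ ∘ f , g ⟩ ⟩ ∎
    where
      reduce : ∀ {Y} {k : _ ⇒ Y} → (k ∘ π₁) ∘ ⟨ f , g ⟩ ≈ k ∘ f
      reduce = ≈-trans (assoc _ _ _) (∘-congˡ (project₁ _ _))

  ⊗-isFunctor : IsFunctor ⊗
  ⊗-isFunctor = record
    { F-resp-≈     = λ (p , q) → ⟨⟩-cong (∘-congʳ p) (∘-congʳ q)
    ; identity     = ≈-trans (⟨⟩-cong (identityˡ _) (identityˡ _)) ⟨π₁,π₂⟩≈id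
    ; homomorphism = λ _ _ →
        ≈-trans (⟨⟩-cong (assoc _ _ _) (assoc _ _ _)) (≈-sym ⊗-∘-⟨⟩)
    }

  α-natural : ∀ {A A′ B B′ D D′} (f : A ⇒ A′) (g : B ⇒ B′) (k : D ⇒ D′) →
              α A′ B′ D′ ∘ (f ⊗₁ g) ⊗₁ k ≈ f ⊗₁ (g ⊗₁ k) ∘ α A B D
  α-natural {A} {B = B} {D = D} f g k = begin
    α _ _ _ ∘ ⟨ f ⊗₁ g ∘ π₁ , k ∘ π₂ ⟩
      ≈⟨ α-∘-⟨⟩ ⟩
    ⟨ π₁ ∘ (f ⊗₁ g ∘ π₁) , ⟨ π₂ ∘ (f ⊗₁ g ∘ π₁) , k ∘ π₂ ⟩ ⟩
      ≈⟨ ⟨⟩-cong (≈-trans (pullˡ (project₁ _ _)) (assoc _ _ _))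
                 (⟨⟩-cong (≈-trans (pullˡ (project₂ _ _)) (assoc _ _ _)) ≈-refl) ⟩
    ⟨ f ∘ (π₁ ∘ π₁) , ⟨ g ∘ (π₂ ∘ π₁) , k ∘ π₂ ⟩ ⟩
      ≈⟨ ≈-trans ⊗-∘-⟨⟩ (⟨⟩-cong ≈-refl ⊗-∘-⟨⟩) ⟨
    f ⊗₁ (g ⊗₁ k) ∘ α A B D ∎

  α⁻¹ : ∀ A B D → A ⊗₀ (B ⊗₀ D) ⇒ (A ⊗₀ B) ⊗₀ D
  α⁻¹ _ _ _ = ⟨ ⟨ π₁ , π₁ ∘ π₂ ⟩ , π₂ ∘ π₂ ⟩

  α⁻¹-∘-α : ∀ A B D → α⁻¹ A B D ∘ α A B D ≈ id
  α⁻¹-∘-α A B D = begin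
    α⁻¹ A B D ∘ α A B D
      ≈⟨ ≈-trans ⟨⟩-∘ (⟨⟩-cong ⟨⟩-∘ ≈-refl) ⟩
    ⟨ ⟨ π₁ ∘ α A B D , (π₁ ∘ π₂) ∘ α A B D ⟩ , (π₂ ∘ π₂) ∘ α A B D ⟩
      ≈⟨ ⟨⟩-cong (⟨⟩-cong (project₁ _ _) (≈-trans reduce (project₁ _ _)))
                 (≈-trans reduce (project₂ _ _)) ⟩
    ⟨ ⟨ π₁ ∘ π₁ , π₂ ∘ π₁ ⟩ , π₂ ⟩
      ≈⟨ ⟨⟩-cong ⟨⟩-η ≈-refl ⟩
    ⟨ π₁ , π₂ ⟩
      ≈⟨ ⟨π₁,π₂⟩≈id ⟩
    id ∎
    where
      reduce : ∀ {Y} {k : _ ⇒ Y} → (k ∘ π₂) ∘ α A B D ≈ k ∘ ⟨ π₂ ∘ π₁ , π₂ ⟩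
      reduce = ≈-trans (assoc _ _ _) (∘-congˡ (project₂ _ _))

  α-∘-α⁻¹ : ∀ A B D → α A B D ∘ α⁻¹ A B D ≈ id
  α-∘-α⁻¹ A B D = begin
    α A B D ∘ α⁻¹ A B D
      ≈⟨ α-∘-⟨⟩ ⟩
    ⟨ π₁ ∘ ⟨ π₁ , π₁ ∘ π₂ ⟩ , ⟨ π₂ ∘ ⟨ π₁ , π₁ ∘ π₂ ⟩ , π₂ ∘ π₂ ⟩ ⟩
      ≈⟨ ⟨⟩-cong (project₁ _ _) (⟨⟩-cong (project₂ _ _) ≈-refl) ⟩
    ⟨ π₁ , ⟨ π₁ ∘ π₂ , π₂ ∘ π₂ ⟩ ⟩
      ≈⟨ ⟨⟩-cong ≈-refl ⟨⟩-η ⟩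
    ⟨ π₁ , π₂ ⟩
      ≈⟨ ⟨π₁,π₂⟩≈id ⟩
    id ∎

  l-isIso : ∀ A → IsIso C (l A)
  l-isIso A = record
    { inverse = ⟨ ! , id ⟩
    ; isoˡ    = ≈-trans ⟨⟩-∘ (≈-trans
                  -- Both `! ∘ π₂` and `π₁` end in `⊤`, so each equals `!`.
                  (⟨⟩-cong (≈-trans (≈-sym (!-unique _)) (!-unique _)) (identityˡ _))
                  ⟨π₁,π₂⟩≈id)
    ; isoʳ    = project₂ _ _
    }

  r-isIso : ∀ A → IsIso C (r A)
  r-isIso A = record
    { inverse = ⟨ id , ! ⟩
    ; isoˡ    = ≈-trans ⟨⟩-∘ (≈-trans
                  (⟨⟩-cong (identityˡ _) (≈-trans (≈-sym (!-unique _)) (!-unique _)))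
                  ⟨π₁,π₂⟩≈id)
    ; isoʳ    = project₁ _ _
    }

  -- Both sides normalise to the same nested pairing of iterated projections. The right side is
  -- expanded in reverse; `α₁`, `α₂` and `α₃` compute its first three components, and the fourth is
  -- an identity law.
  pentagon : ∀ A B D E →
             α A B (D ⊗₀ E) ∘ α (A ⊗₀ B) D E
               ≈ id ⊗₁ α B D E ∘ α A (B ⊗₀ D) E ∘ α A B D ⊗₁ id
  pentagon A B D E = begin
    α A B (D ⊗₀ E) ∘ α (A ⊗₀ B) D E
      ≈⟨ α-∘-⟨⟩ ⟩
    ⟨ π₁ ∘ (π₁ ∘ π₁) , ⟨ π₂ ∘ (π₁ ∘ π₁) , ⟨ π₂ ∘ π₁ , π₂ ⟩ ⟩ ⟩
      ≈⟨ ⟨⟩-cong α₁ (⟨⟩-cong α₂ (⟨⟩-cong α₃ (identityˡ _))) ⟨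
    ⟨ id ∘ (π₁ ∘ (α A B D ∘ π₁))
    , ⟨ π₁ ∘ (π₂ ∘ (α A B D ∘ π₁))
      , ⟨ π₂ ∘ (π₂ ∘ (α A B D ∘ π₁)) , id ∘ π₂ ⟩ ⟩ ⟩
      ≈⟨ ⟨⟩-cong ≈-refl α-∘-⟨⟩ ⟨
    ⟨ id ∘ (π₁ ∘ (α A B D ∘ π₁))
    , α B D E ∘ ⟨ π₂ ∘ (α A B D ∘ π₁) , id ∘ π₂ ⟩ ⟩
      ≈⟨ ⊗-∘-⟨⟩ ⟨
    id ⊗₁ α B D E ∘ ⟨ π₁ ∘ (α A B D ∘ π₁) , ⟨ π₂ ∘ (α A B D ∘ π₁) , id ∘ π₂ ⟩ ⟩
      ≈⟨ ∘-congˡ α-∘-⟨⟩ ⟨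
    id ⊗₁ α B D E ∘ (α A (B ⊗₀ D) E ∘ α A B D ⊗₁ id) ∎
    where
      α₁ : id ∘ (π₁ ∘ (α A B D ∘ π₁ {B = E})) ≈ π₁ ∘ (π₁ ∘ π₁)
      α₁ = ≈-trans (identityˡ _)
             (≈-trans (pullˡ (project₁ _ _)) (assoc _ _ _))

      rest : π₂ ∘ (α A B D ∘ π₁ {B = E}) ≈ ⟨ π₂ ∘ π₁ , π₂ ⟩ ∘ π₁
      rest = pullˡ (project₂ _ _)

      α₂ : π₁ ∘ (π₂ ∘ (α A B D ∘ π₁ {B = E})) ≈ π₂ ∘ (π₁ ∘ π₁)
      α₂ = ≈-trans (∘-congˡ rest) (≈-trans (pullˡ (project₁ _ _)) (assoc _ _ _))

      α₃ : π₂ ∘ (π₂ ∘ (α A B D ∘ π₁ {B = E})) ≈ π₂ ∘ π₁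
      α₃ = ≈-trans (∘-congˡ rest) (pullˡ (project₂ _ _))

  triangle : ∀ A B → id ⊗₁ l B ∘ α A unit B ≈ r A ⊗₁ id
  triangle A B = ≈-trans ⊗-∘-⟨⟩
    (⟨⟩-cong (identityˡ _) (≈-trans (project₂ _ _) (≈-sym (identityˡ _))))

  isMonoidalCategory : IsMonoidalCategory (cartesianMonoidal P)
  isMonoidalCategory = record
    { isCategory  = isCategory
    ; ⊗-isFunctor = ⊗-isFunctor
    ; α-natural   = α-natural
    ; l-natural   = λ _ → project₂ _ _
    ; r-natural   = λ _ → project₁ _ _
    ; α-isIso     = λ A B D → record
      { inverse = α⁻¹ A B D ; isoˡ = α⁻¹-∘-α A B D ; isoʳ = α-∘-α⁻¹ A B D }
    ; l-isIso     = l-isIso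
    ; r-isIso     = r-isIso
    ; pentagon    = pentagon
    ; triangle    = triangle
    }

-- A monoidal category acting on itself.

selfAction-isActegory : {M : RawCategory o h e} {𝓜 : RawMonoidal M} →
                        IsMonoidalCategory 𝓜 → IsActegory (selfAction 𝓜)
selfAction-isActegory isMonoidal = record
  { isCategory    = isCategory
  ; act-isFunctor = ⊗-isFunctor
  ; η-natural     = l-natural
  ; μ-natural     = α-natural
  ; η-isIso       = l-isIso
  ; μ-isIso       = α-isIso
  ; μ-assoc       = pentagon
  ; μ-unit        = triangle
  }
  where open IsMonoidalCategory isMonoidal

-- Substitution calculus of raw terms, up to propositional equality.

module SubstitutionProperties (S : Signature ℓ) where
  open Syntax S

  private
    variable
      τ τ′   : VTy
      τs     : List VTy
      A A′ B : CTy
      Γ Γ′ Γ″ : VCtx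
      Δ      : CCtx

  lookup-[]* : (σ : All (Γ ⊢ᵛ_) τs) (θ : Sub Γ′ Γ) (x : τ ∈ τs) →
               All.lookup (σ [ θ ]*) x ≡ All.lookup σ x [ θ ]ᵛ
  lookup-[]* (M ∷ σ) θ (here refl) = refl
  lookup-[]* (M ∷ σ) θ (there x)   = lookup-[]* σ θ x

  mutual
    []ᵛ-∘ : (M : Γ ⊢ᵛ τ) (σ : Sub Γ′ Γ) (θ : Sub Γ″ Γ′) →
            M [ σ ]ᵛ [ θ ]ᵛ ≡ M [ σ [ θ ]* ]ᵛ
    []ᵛ-∘ (var x)    σ θ = sym (lookup-[]* σ θ x)
    []ᵛ-∘ (fun f Ms) σ θ = cong (fun f) ([]*-∘ Ms σ θ)
    []ᵛ-∘ ⟨ M , N ⟩  σ θ = cong₂ ⟨_,_⟩ ([]ᵛ-∘ M σ θ) ([]ᵛ-∘ N σ θ)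
    []ᵛ-∘ (π₁ M)     σ θ = cong π₁ ([]ᵛ-∘ M σ θ)
    []ᵛ-∘ (π₂ M)     σ θ = cong π₂ ([]ᵛ-∘ M σ θ)
    []ᵛ-∘ ⋆          σ θ = refl

    []*-∘ : (Ms : All (Γ ⊢ᵛ_) τs) (σ : Sub Γ′ Γ) (θ : Sub Γ″ Γ′) →
            Ms [ σ ]* [ θ ]* ≡ Ms [ σ [ θ ]* ]*
    []*-∘ []       σ θ = refl
    []*-∘ (M ∷ Ms) σ θ = cong₂ _∷_ ([]ᵛ-∘ M σ θ) ([]*-∘ Ms σ θ)

  lookup-tabulate : (f : ∀ {τ} → τ ∈ Γ → Γ′ ⊢ᵛ τ) (x : τ ∈ Γ) →
                    All.lookup (All.tabulate f) x ≡ f x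
  lookup-tabulate f (here refl) = refl
  lookup-tabulate f (there x)   = lookup-tabulate (f ∘′ there) x

  -- Reading a renaming as a substitution turns facts about weakening into instances of `[]*-∘`.
  vars : Γ ⊆ Γ′ → Sub Γ′ Γ
  vars ρ = All.tabulate (var ∘′ ρ)

  mutual
    rename-as-[]ᵛ : (ρ : Γ ⊆ Γ′) (M : Γ ⊢ᵛ τ) → rename ρ M ≡ M [ vars ρ ]ᵛ
    rename-as-[]ᵛ ρ (var x)    = sym (lookup-tabulate (var ∘′ ρ) x)
    rename-as-[]ᵛ ρ (fun f Ms) = cong (fun f) (rename*-as-[]* ρ Ms)
    rename-as-[]ᵛ ρ ⟨ M , N ⟩  = cong₂ ⟨_,_⟩ (rename-as-[]ᵛ ρ M) (rename-as-[]ᵛ ρ N)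
    rename-as-[]ᵛ ρ (π₁ M)     = cong π₁ (rename-as-[]ᵛ ρ M)
    rename-as-[]ᵛ ρ (π₂ M)     = cong π₂ (rename-as-[]ᵛ ρ M)
    rename-as-[]ᵛ ρ ⋆          = refl

    rename*-as-[]* : (ρ : Γ ⊆ Γ′) (Ms : All (Γ ⊢ᵛ_) τs) →
                     rename* ρ Ms ≡ Ms [ vars ρ ]*
    rename*-as-[]* ρ []       = refl
    rename*-as-[]* ρ (M ∷ Ms) = cong₂ _∷_ (rename-as-[]ᵛ ρ M) (rename*-as-[]* ρ Ms)

  vars-[]* : (ρ : Γ ⊆ Γ′) (σ : Sub Γ″ Γ′) →
             vars ρ [ σ ]* ≡ All.tabulate (λ x → All.lookup σ (ρ x))
  vars-[]* {Γ = []}    ρ σ = refl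
  vars-[]* {Γ = _ ∷ _} ρ σ = cong (All.lookup σ (ρ (here refl)) ∷_) (vars-[]* (ρ ∘′ there) σ)

  tabulate-lookup : (σ : Sub Γ′ Γ) → All.tabulate (All.lookup σ) ≡ σ
  tabulate-lookup []      = refl
  tabulate-lookup (M ∷ σ) = cong (M ∷_) (tabulate-lookup σ)

  -- A weakened term does not mention the newest variable, so `M` is dropped. Formally, `vars there`
  -- followed by `M ∷ θ` is `θ`.
  weaken-[]* : (σ : Sub Γ′ Γ) (M : Γ″ ⊢ᵛ τ) (θ : Sub Γ″ Γ′) →
               weaken σ [ M ∷ θ ]* ≡ σ [ θ ]*
  weaken-[]* σ M θ =
    trans (cong (_[ M ∷ θ ]*) (rename*-as-[]* there σ))
      (trans ([]*-∘ σ (vars there) (M ∷ θ))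
        (cong (σ [_]*) (trans (vars-[]* there (M ∷ θ)) (tabulate-lookup θ))))

  -- Weakening is composition on the right with `vars there`, so this is associativity of
  -- composition.
  weaken-∘ : (σ : Sub Γ′ Γ) (θ : Sub Γ″ Γ′) →
             σ [ weaken {τ = τ} θ ]* ≡ weaken (σ [ θ ]*)
  weaken-∘ σ θ =
    trans (cong (σ [_]*) (rename*-as-[]* there θ))
      (trans (sym ([]*-∘ σ θ (vars there))) (sym (rename*-as-[]* there (σ [ θ ]*))))

  -- Serves the `letval` case of `[]ᶜ-∘`, where the substitutions pass under a binder.
  lift-∘ : (σ : Sub Γ′ Γ) (θ : Sub Γ″ Γ′) →
           lift {τ = τ} σ [ lift θ ]* ≡ lift (σ [ θ ]*)
  lift-∘ σ θ = cong (_ ∷_) (trans (weaken-[]* σ _ (weaken θ)) (weaken-∘ σ θ))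

  []ᶜ-∘ : (N : Γ ∣ Δ ⊢ᶜ A) (σ : Sub Γ′ Γ) (θ : Sub Γ″ Γ′) →
          N [ σ ]ᶜ [ θ ]ᶜ ≡ N [ σ [ θ ]* ]ᶜ
  []ᶜ-∘ cvar          σ θ = refl
  []ᶜ-∘ (comp g Ms N) σ θ = cong₂ (comp g) ([]*-∘ Ms σ θ) ([]ᶜ-∘ N σ θ)
  []ᶜ-∘ (gen k Ms)    σ θ = cong (gen k) ([]*-∘ Ms σ θ)
  []ᶜ-∘ (val M)       σ θ = cong val ([]ᵛ-∘ M σ θ)
  []ᶜ-∘ (letval N N′) σ θ = cong₂ letval ([]ᶜ-∘ N σ θ)
    (trans ([]ᶜ-∘ N′ (lift σ) (lift θ)) (cong (N′ [_]ᶜ) (lift-∘ σ θ)))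

  mutual
    []ᵛ-ids : (M : Γ ⊢ᵛ τ) → M [ ids ]ᵛ ≡ M
    []ᵛ-ids (var x)    = lookup-tabulate var x
    []ᵛ-ids (fun f Ms) = cong (fun f) ([]*-ids Ms)
    []ᵛ-ids ⟨ M , N ⟩  = cong₂ ⟨_,_⟩ ([]ᵛ-ids M) ([]ᵛ-ids N)
    []ᵛ-ids (π₁ M)     = cong π₁ ([]ᵛ-ids M)
    []ᵛ-ids (π₂ M)     = cong π₂ ([]ᵛ-ids M)
    []ᵛ-ids ⋆          = refl

    []*-ids : (Ms : All (Γ ⊢ᵛ_) τs) → Ms [ ids ]* ≡ Ms
    []*-ids []       = refl
    []*-ids (M ∷ Ms) = cong₂ _∷_ ([]ᵛ-ids M) ([]*-ids Ms)

  -- By definition `ids` is `vars` of the identity renaming, and the tail of the longer `ids` is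
  -- `vars there`; the proof connects the two.
  lift-ids : lift {τ = τ} (ids {Γ}) ≡ ids
  lift-ids = cong (_ ∷_) (trans (rename*-as-[]* there ids)
    (trans (vars-[]* (λ x → x) (vars there))
           (tabulate-lookup (vars there))))

  []ᶜ-ids : (N : Γ ∣ Δ ⊢ᶜ A) → N [ ids ]ᶜ ≡ N
  []ᶜ-ids cvar          = refl
  []ᶜ-ids (comp g Ms N) = cong₂ (comp g) ([]*-ids Ms) ([]ᶜ-ids N)
  []ᶜ-ids (gen k Ms)    = cong (gen k) ([]*-ids Ms)
  []ᶜ-ids (val M)       = cong val ([]ᵛ-ids M)
  []ᶜ-ids (letval N N′) = cong₂ letval ([]ᶜ-ids N)
    (trans (cong (N′ [_]ᶜ) lift-ids) ([]ᶜ-ids N′))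

  -- The computation variable lies at the end of a single spine of `comp` arguments and `letval`
  -- heads, and `gen` and `val` cannot contain it. Hence three cases suffice here and in the next
  -- two lemmas.
  ⟪cvar⟫ : (K : Γ ∣ just A ⊢ᶜ A′) → K ⟪ cvar ⟫ ≡ K
  ⟪cvar⟫ cvar          = refl
  ⟪cvar⟫ (comp g Ms K) = cong (comp g Ms) (⟪cvar⟫ K)
  ⟪cvar⟫ (letval K N)  = cong (λ L → letval L N) (⟪cvar⟫ K)

  ⟪⟫-assoc : (K : Γ ∣ just A ⊢ᶜ A′) (L : Γ ∣ just B ⊢ᶜ A) (N : Γ ∣ Δ ⊢ᶜ B) →
             K ⟪ L ⟫ ⟪ N ⟫ ≡ K ⟪ L ⟪ N ⟫ ⟫
  ⟪⟫-assoc cvar          L N = refl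
  ⟪⟫-assoc (comp g Ms K) L N = cong (comp g Ms) (⟪⟫-assoc K L N)
  ⟪⟫-assoc (letval K N′) L N = cong (λ K′ → letval K′ N′) (⟪⟫-assoc K L N)

  -- Plugging leaves the body of a `letval` alone, so the lifted substitution meets the same body on
  -- both sides. This interchange enters associativity of composition and functoriality of the
  -- action.
  ⟪⟫-[]ᶜ : (K : Γ ∣ just A ⊢ᶜ A′) (N : Γ ∣ Δ ⊢ᶜ A) (σ : Sub Γ′ Γ) →
           K ⟪ N ⟫ [ σ ]ᶜ ≡ K [ σ ]ᶜ ⟪ N [ σ ]ᶜ ⟫
  ⟪⟫-[]ᶜ cvar          N σ = refl
  ⟪⟫-[]ᶜ (comp g Ms K) N σ = cong (comp g (Ms [ σ ]*)) (⟪⟫-[]ᶜ K N σ)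
  ⟪⟫-[]ᶜ (letval K N′) N σ = cong (λ L → letval L (N′ [ lift σ ]ᶜ)) (⟪⟫-[]ᶜ K N σ)

module TermModelProperties (𝓣 : Theory ℓ) where
  open Theory 𝓣
  open Syntax signature
  open Derivability 𝓣
  open TermModel 𝓣
  open SubstitutionProperties signature

  private
    variable
      τ τ′ τ″ τ‴ : VTy
      τs   : List VTy
      A A′ : CTy
      Γ Γ′ : VCtx
      Δ Δ′ : CCtx

  -- Derivable equality as a congruence for substitution.

  ≡⇒≈ᵛ : {M M′ : Γ ⊢ᵛ τ} → M ≡ M′ → M ≈ᵛ M′
  ≡⇒≈ᵛ refl = ≈-refl

  ≡⇒≈ᶜ : {N N′ : Γ ∣ Δ ⊢ᶜ A} → N ≡ N′ → N ≈ᶜ N′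
  ≡⇒≈ᶜ refl = ≈-refl

  lookup-cong : {σ σ′ : Sub Γ′ Γ} → σ ≈* σ′ → (x : τ ∈ Γ) →
                All.lookup σ x ≈ᵛ All.lookup σ′ x
  lookup-cong (p ∷ ps) (here refl) = p
  lookup-cong (p ∷ ps) (there x)   = lookup-cong ps x

  mutual
    -- The rule `substitution` varies the term under a fixed substitution. Varying the substitution
    -- instead needs an induction on the term, using the congruence rules.
    []ᵛ-congʳ : (M : Γ ⊢ᵛ τ) {σ σ′ : Sub Γ′ Γ} → σ ≈* σ′ → M [ σ ]ᵛ ≈ᵛ M [ σ′ ]ᵛ
    []ᵛ-congʳ (var x)    p = lookup-cong p x
    []ᵛ-congʳ (fun f Ms) p = fun-cong f ([]*-congʳ Ms p)
    []ᵛ-congʳ ⟨ M , N ⟩  p = pair-cong ([]ᵛ-congʳ M p) ([]ᵛ-congʳ N p)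
    []ᵛ-congʳ (π₁ M)     p = π₁-cong ([]ᵛ-congʳ M p)
    []ᵛ-congʳ (π₂ M)     p = π₂-cong ([]ᵛ-congʳ M p)
    []ᵛ-congʳ ⋆          p = ≈-refl

    []*-congʳ : (Ms : All (Γ ⊢ᵛ_) τs) {σ σ′ : Sub Γ′ Γ} → σ ≈* σ′ →
                Ms [ σ ]* ≈* Ms [ σ′ ]*
    []*-congʳ []       p = []
    []*-congʳ (M ∷ Ms) p = []ᵛ-congʳ M p ∷ []*-congʳ Ms p

  -- Renaming is substitution by `vars ρ`, to which the rule `substitution` applies.
  rename-cong : (ρ : Γ ⊆ Γ′) {M M′ : Γ ⊢ᵛ τ} → M ≈ᵛ M′ → rename ρ M ≈ᵛ rename ρ M′
  rename-cong ρ {M} {M′} p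
    rewrite rename-as-[]ᵛ ρ M | rename-as-[]ᵛ ρ M′ = substitution (vars ρ) p

  lift-cong : {σ σ′ : Sub Γ′ Γ} → σ ≈* σ′ → lift {τ = τ} σ ≈* lift σ′
  lift-cong p = ≈-refl ∷ weaken-cong p
    where
      weaken-cong : {σ σ′ : Sub Γ′ Γ} → σ ≈* σ′ → weaken {τ = τ} σ ≈* weaken σ′
      weaken-cong []       = []
      weaken-cong (p ∷ ps) = rename-cong there p ∷ weaken-cong ps

  []ᶜ-congʳ : (N : Γ ∣ Δ ⊢ᶜ A) {σ σ′ : Sub Γ′ Γ} → σ ≈* σ′ → N [ σ ]ᶜ ≈ᶜ N [ σ′ ]ᶜ
  []ᶜ-congʳ cvar          p = ≈-refl
  []ᶜ-congʳ (comp g Ms N) p = comp-cong g ([]*-congʳ Ms p) ([]ᶜ-congʳ N p)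
  []ᶜ-congʳ (gen k Ms)    p = gen-cong k ([]*-congʳ Ms p)
  []ᶜ-congʳ (val M)       p = val-cong ([]ᵛ-congʳ M p)
  []ᶜ-congʳ (letval N N′) p = letval-cong ([]ᶜ-congʳ N p) ([]ᶜ-congʳ N′ (lift-cong p))

  -- Complements `substitutionᶜ`, which varies `K` and keeps the plugged term fixed.
  ⟪⟫-congʳ : (K : Γ ∣ just A ⊢ᶜ A′) {N N′ : Γ ∣ Δ ⊢ᶜ A} → N ≈ᶜ N′ →
             K ⟪ N ⟫ ≈ᶜ K ⟪ N′ ⟫
  ⟪⟫-congʳ cvar          p = p
  ⟪⟫-congʳ (comp g Ms K) p = comp-cong g ≈*-refl (⟪⟫-congʳ K p)
    where
      ≈*-refl : {Ms : All (Γ ⊢ᵛ_) τs} → Ms ≈* Ms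
      ≈*-refl {Ms = []}     = []
      ≈*-refl {Ms = _ ∷ _} = ≈-refl ∷ ≈*-refl
  ⟪⟫-congʳ (letval K N)  p = letval-cong (⟪⟫-congʳ K p) ≈-refl

  infixl 8 _[_]₁

  _[_]₁ : τ ∷ [] ∣ Δ ⊢ᶜ A → Γ ⊢ᵛ τ → Γ ∣ Δ ⊢ᶜ A
  N [ M ]₁ = N [ M ∷ [] ]ᶜ

  []₁-cong : {N N′ : τ ∷ [] ∣ Δ ⊢ᶜ A} {M M′ : Γ ⊢ᵛ τ} → N ≈ᶜ N′ → M ≈ᵛ M′ →
             N [ M ]₁ ≈ᶜ N′ [ M′ ]₁
  []₁-cong {N = N} {M′ = M′} p q =
    ≈-trans ([]ᶜ-congʳ N (q ∷ [])) (substitutionᵛ (M′ ∷ []) p)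

  []₁-∘ : (N : τ ∷ [] ∣ Δ ⊢ᶜ A) (M : τ′ ∷ [] ⊢ᵛ τ) (L : Γ ⊢ᵛ τ′) →
          N [ M ]₁ [ L ]₁ ≈ᶜ N [ M [ L ∷ [] ]ᵛ ]₁
  []₁-∘ N M L = ≡⇒≈ᶜ ([]ᶜ-∘ N (M ∷ []) (L ∷ []))

  ⟪⟫-cong : {K K′ : Γ ∣ just A ⊢ᶜ A′} {N N′ : Γ ∣ Δ ⊢ᶜ A} → K ≈ᶜ K′ → N ≈ᶜ N′ →
            K ⟪ N ⟫ ≈ᶜ K′ ⟪ N′ ⟫
  ⟪⟫-cong {K = K} {N′ = N′} p q = ≈-trans (⟪⟫-congʳ K q) (substitutionᶜ N′ p)

  -- The value category and its finite products.

  𝒱-isCategory : IsCategory 𝒱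
  𝒱-isCategory = record
    { isEquivalence = record { refl = ≈-refl ; sym = ≈-sym ; trans = ≈-trans }
    ; ∘-resp-≈      = λ {_} {_} {_} {M} p q →
        ≈-trans ([]ᵛ-congʳ M (q ∷ [])) (substitution _ p)
    ; identityˡ     = λ _ → ≈-refl
    ; identityʳ     = λ M → ≡⇒≈ᵛ ([]ᵛ-ids M)
    ; assoc         = λ M M′ M″ → ≡⇒≈ᵛ ([]ᵛ-∘ M (M′ ∷ []) (M″ ∷ []))
    }

  -- Composing `π₁ x₀` with a term computes to `π₁` of that term. The β-rules are therefore the
  -- projection laws as they stand, and uniqueness is surjective pairing `⊠-η` after rewriting along
  -- the hypotheses.
  𝒱-isCartesian : IsCartesianCategory 𝒱-products
  𝒱-isCartesian = record
    { isCategory = 𝒱-isCategory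
    ; !-unique   = 𝟙-η
    ; project₁   = π₁-β
    ; project₂   = π₂-β
    ; unique     = λ K p q → ≈-trans (≈-sym (pair-cong p q)) (⊠-η K)
    }

  open CartesianProperties 𝒱-isCartesian public
    using () renaming (isMonoidalCategory to 𝒱-isMonoidal)

  private
    module 𝒱 where
      open RawCategory 𝒱 public
      open RawMonoidal 𝒱-monoidal public
      open IsCategory 𝒱-isCategory public
      open IsMonoidalCategory 𝒱-isMonoidal public
        hiding (isCategory)
      module ⊗ = IsFunctor ⊗-isFunctor

  -- The computation category.

  ≈ʰ-isEquivalence : ∀ {X Y} → IsEquivalence (_≈ʰ_ {X} {Y})
  ≈ʰ-isEquivalence = record { refl = reflexive ; sym = symmetric ; trans = transitive }
    where
      reflexive : ∀ {X Y} {f : CHom X Y} → f ≈ʰ f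
      reflexive {f = pure _} = pure ≈-refl
      reflexive {f = _ , _}  = ≈-refl , ≈-refl

      symmetric : ∀ {X Y} {f g : CHom X Y} → f ≈ʰ g → g ≈ʰ f
      symmetric (pure p) = pure (≈-sym p)
      symmetric (p , q)  = ≈-sym p , ≈-sym q

      transitive : ∀ {X Y} {f g k : CHom X Y} → f ≈ʰ g → g ≈ʰ k → f ≈ʰ k
      transitive (pure p) (pure p′) = pure (≈-trans p p′)
      transitive (p , q)  (p′ , q′) = ≈-trans p p′ , ≈-trans q q′

  ∘ʰ-resp-≈ : ∀ {X Y Z} {f f′ : CHom Y Z} {g g′ : CHom X Y} →
              f ≈ʰ f′ → g ≈ʰ g′ → (f ∘ʰ g) ≈ʰ (f′ ∘ʰ g′)
  ∘ʰ-resp-≈ (pure p) (pure q)  = pure (𝒱.∘-resp-≈ p q)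
  ∘ʰ-resp-≈ (p , p′) (pure q)  = 𝒱.∘-resp-≈ p q , []₁-cong p′ q
  ∘ʰ-resp-≈ (p , p′) (q , q′) = 𝒱.∘-resp-≈ p q , ⟪⟫-cong ([]₁-cong p′ q) q′

  ∘ʰ-identityˡ : ∀ {X Y} (f : CHom X Y) → (idʰ ∘ʰ f) ≈ʰ f
  ∘ʰ-identityˡ (pure M) = pure (𝒱.identityˡ M)
  ∘ʰ-identityˡ (M , N)  = 𝒱.identityˡ M , ≈-refl

  ∘ʰ-identityʳ : ∀ {X Y} (f : CHom X Y) → (f ∘ʰ idʰ) ≈ʰ f
  ∘ʰ-identityʳ (pure M)                = pure (𝒱.identityʳ M)
  -- `idʰ` is defined by cases on the computation context, so `Δ` has to be known before the
  -- composite computes.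
  ∘ʰ-identityʳ (_,_ {Δ = nothing} M N) = 𝒱.identityʳ M , ≡⇒≈ᶜ ([]ᶜ-ids N)
  ∘ʰ-identityʳ (_,_ {Δ = just _}  M N) =
    𝒱.identityʳ M , ≡⇒≈ᶜ (trans (⟪cvar⟫ _) ([]ᶜ-ids N))

  -- A `pure` factor forces every factor applied before it to be `pure`, which leaves four shapes.
  -- In the last two, value substitution is first distributed over plugging.
  ∘ʰ-assoc : ∀ {W X Y Z} (f : CHom Y Z) (g : CHom X Y) (k : CHom W X) →
             ((f ∘ʰ g) ∘ʰ k) ≈ʰ (f ∘ʰ (g ∘ʰ k))
  ∘ʰ-assoc (pure M)  (pure M′)  (pure M″)  = pure (𝒱.assoc M M′ M″)
  ∘ʰ-assoc (M , N)   (pure M′)  (pure M″)  = 𝒱.assoc M M′ M″ , []₁-∘ N M′ M″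
  ∘ʰ-assoc (M , N)   (M′ , N′)  (pure M″)  = 𝒱.assoc M M′ M″ ,
    ≈-trans (≡⇒≈ᶜ (⟪⟫-[]ᶜ (N [ M′ ]₁) N′ (M″ ∷ []))) (⟪⟫-cong ([]₁-∘ N M′ M″) ≈-refl)
  ∘ʰ-assoc (M , N)   (M′ , N′)  (M″ , N″)  = 𝒱.assoc M M′ M″ ,
    ≈-trans (≡⇒≈ᶜ (trans (cong (_⟪ N″ ⟫) (⟪⟫-[]ᶜ (N [ M′ ]₁) N′ (M″ ∷ [])))
                         (⟪⟫-assoc (N [ M′ ]₁ [ M″ ]₁) (N′ [ M″ ]₁) N″)))
            (⟪⟫-cong ([]₁-∘ N M′ M″) ≈-refl)

  𝒞-isCategory : IsCategory 𝒞
  𝒞-isCategory = record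
    { isEquivalence = ≈ʰ-isEquivalence
    ; ∘-resp-≈      = ∘ʰ-resp-≈
    ; identityˡ     = ∘ʰ-identityˡ
    ; identityʳ     = ∘ʰ-identityʳ
    ; assoc         = ∘ʰ-assoc
    }

  open CategoryReasoning 𝒞-isCategory using (homSetoid)
  module _ {X Y : CObj} where
    open Setoid (homSetoid X Y) public using ()
      renaming (refl to ≈ʰ-refl; sym to ≈ʰ-sym; trans to ≈ʰ-trans; reflexive to ≡⇒≈ʰ)

  -- Transfer of value morphisms by retagging.

  retag-cong : {M M′ : τ ∷ [] ⊢ᵛ τ′} → M ≈ᵛ M′ → retag {Δ = Δ} M ≈ʰ retag M′
  retag-cong {Δ = nothing} p = pure p
  retag-cong {Δ = just _}  p = p , ≈-refl

  -- The equality is strict because value substitution fixes `cvar` and plugging `cvar` into itself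
  -- returns it.
  retag-∘ : (M : τ′ ∷ [] ⊢ᵛ τ″) (M′ : τ ∷ [] ⊢ᵛ τ′) →
            (retag {Δ = Δ} M ∘ʰ retag M′) ≡ retag (M 𝒱.∘ M′)
  retag-∘ {Δ = nothing} M M′ = refl
  retag-∘ {Δ = just _}  M M′ = refl

  ·-retag : (L : τ ∷ [] ⊢ᵛ τ′) (M : τ″ ∷ [] ⊢ᵛ τ‴) →
            (L ·ʰ retag {Δ = Δ} M) ≡ retag (L 𝒱.⊗₁ M)
  ·-retag {Δ = nothing} L M = refl
  ·-retag {Δ = just _}  L M = refl

  retag-isIso : {M : τ ∷ [] ⊢ᵛ τ′} → IsIso 𝒱 M → IsIso 𝒞 (retag {Δ = Δ} M)
  retag-isIso {M = M} i = record
    { inverse = retag inverse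
    ; isoˡ    = ≈ʰ-trans (≡⇒≈ʰ (retag-∘ inverse M)) (retag-cong isoˡ)
    ; isoʳ    = ≈ʰ-trans (≡⇒≈ʰ (retag-∘ M inverse)) (retag-cong isoʳ)
    }
    where open IsIso i

  -- Functoriality of the action.

  ·-resp-≈ : {L L′ : τ ∷ [] ⊢ᵛ τ′} {f f′ : CHom (τ″ , Δ) (τ‴ , Δ′)} →
             L ≈ᵛ L′ → f ≈ʰ f′ → (L ·ʰ f) ≈ʰ (L′ ·ʰ f′)
  ·-resp-≈ p (pure q) = pure (𝒱.⊗.F-resp-≈ (p , q))
  ·-resp-≈ p (q , q′) = 𝒱.⊗.F-resp-≈ (p , q) , []₁-cong q′ ≈-refl

  ·-identity : (x₀ {τ} ·ʰ idʰ {τ′ , Δ}) ≈ʰ idʰ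
  ·-identity = ≈ʰ-trans (≡⇒≈ʰ (·-retag x₀ x₀)) (retag-cong 𝒱.⊗.identity)

  -- Both sides are `N` at `M [ π₂ x₀ ∷ [] ]ᵛ`, the right one by `π₂-β`, which discards `L`. This is
  -- the computation part of `·-homomorphism`.
  []₁-π₂-∘ : (N : τ′ ∷ [] ∣ Δ ⊢ᶜ A) (L : τ ⊠ τ″ ∷ [] ⊢ᵛ τ‴) (M : τ″ ∷ [] ⊢ᵛ τ′) →
             N [ M ]₁ [ π₂ x₀ ]₁ ≈ᶜ N [ π₂ x₀ ]₁ [ ⟨ L , M [ π₂ x₀ ∷ [] ]ᵛ ⟩ ]₁
  []₁-π₂-∘ N L M =
    ≈-trans ([]₁-∘ N M (π₂ x₀))
      (≈-sym (≈-trans ([]₁-∘ N (π₂ x₀) _) ([]₁-cong ≈-refl (π₂-β L _))))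

  ·-homomorphism : ∀ {τ₁ τ₂ τ₃ τ₄ τ₅ τ₆ Δ₁ Δ₂ Δ₃}
                   (L : τ₂ ∷ [] ⊢ᵛ τ₃) (f : CHom (τ₅ , Δ₂) (τ₆ , Δ₃))
                   (L′ : τ₁ ∷ [] ⊢ᵛ τ₂) (g : CHom (τ₄ , Δ₁) (τ₅ , Δ₂)) →
                   ((L 𝒱.∘ L′) ·ʰ (f ∘ʰ g)) ≈ʰ ((L ·ʰ f) ∘ʰ (L′ ·ʰ g))
  ·-homomorphism L (pure M) L′ (pure M′) =
    pure (𝒱.⊗.homomorphism (L , M) (L′ , M′))
  ·-homomorphism L (M , N)  L′ (pure M′) =
    𝒱.⊗.homomorphism (L , M) (L′ , M′) , []₁-π₂-∘ N _ M′
  ·-homomorphism L (M , N)  L′ (M′ , N′) =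
    𝒱.⊗.homomorphism (L , M) (L′ , M′) ,
    -- The middle object has a computation part, so substitution of the second projection must first
    -- be distributed over plugging `N′`.
    ≈-trans (≡⇒≈ᶜ (⟪⟫-[]ᶜ (N [ M′ ]₁) N′ (π₂ x₀ ∷ [])))
            (⟪⟫-cong ([]₁-π₂-∘ N _ M′) ≈-refl)

  act-isFunctor : IsFunctor (RawAction.act 𝒞-action)
  act-isFunctor = record
    { F-resp-≈     = λ (p , q) → ·-resp-≈ p q
    ; identity     = ·-identity
    ; homomorphism = λ (L , f) (L′ , g) → ·-homomorphism L f L′ g
    }

  -- Naturality and coherence of the structure maps.

  open RawAction 𝒞-action using (η; μ)

  η-natural : ∀ {c c′} (f : CHom c c′) → (η c′ ∘ʰ (x₀ ·ʰ f)) ≈ʰ (f ∘ʰ η c)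
  η-natural (pure M)                = pure (𝒱.l-natural M)
  η-natural (_,_ {Δ = nothing} M N) = 𝒱.l-natural M , ≈-refl
  η-natural (_,_ {Δ = just _}  M N) = 𝒱.l-natural M , ≡⇒≈ᶜ (sym (⟪cvar⟫ _))

  -- Reassociation keeps the last factor: `π₂` after `π₂` after `α` is `π₂`. This is the computation
  -- part of `μ-natural`.
  []₁-π₂π₂-α : ∀ {τ₁ τ₂ τ₃} (N : τ₃ ∷ [] ∣ Δ ⊢ᶜ A) →
               N [ π₂ x₀ ]₁ ≈ᶜ N [ π₂ x₀ ]₁ [ π₂ x₀ ]₁ [ 𝒱.α τ₁ τ₂ τ₃ ]₁
  []₁-π₂π₂-α {τ₁ = τ₁} {τ₂} {τ₃} N = ≈-sym
    (≈-trans ([]₁-∘ (N [ π₂ x₀ ]₁) (π₂ x₀) (𝒱.α τ₁ τ₂ τ₃))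
      (≈-trans ([]₁-∘ N (π₂ x₀) (π₂ (𝒱.α τ₁ τ₂ τ₃)))
        ([]₁-cong ≈-refl (≈-trans (π₂-cong (π₂-β _ _)) (π₂-β _ _)))))

  μ-natural : ∀ {τ₁ τ₁′ τ₂ τ₂′ c c′}
              (L : τ₁ ∷ [] ⊢ᵛ τ₁′) (L′ : τ₂ ∷ [] ⊢ᵛ τ₂′) (f : CHom c c′) →
              (μ τ₁′ τ₂′ c′ ∘ʰ ((L 𝒱.⊗₁ L′) ·ʰ f)) ≈ʰ ((L ·ʰ (L′ ·ʰ f)) ∘ʰ μ τ₁ τ₂ c)
  μ-natural L L′ (pure M)                = pure (𝒱.α-natural L L′ M)
  μ-natural L L′ (_,_ {Δ = nothing} M N) = 𝒱.α-natural L L′ M , []₁-π₂π₂-α N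
  μ-natural L L′ (_,_ {Δ = just _}  M N) = 𝒱.α-natural L L′ M ,
    ≈-trans ([]₁-π₂π₂-α N) (≡⇒≈ᶜ (sym (⟪cvar⟫ _)))

  μ-assoc : ∀ τ₁ τ₂ τ₃ c →
            (μ τ₁ τ₂ (RawAction._·₀_ 𝒞-action τ₃ c) ∘ʰ μ (τ₁ ⊠ τ₂) τ₃ c)
              ≈ʰ ((x₀ ·ʰ μ τ₂ τ₃ c) ∘ʰ (μ τ₁ (τ₂ ⊠ τ₃) c ∘ʰ (𝒱.α τ₁ τ₂ τ₃ ·ʰ idʰ)))
  μ-assoc τ₁ τ₂ τ₃ (τ , nothing) = pure (𝒱.pentagon τ₁ τ₂ τ₃ τ)
  -- Every factor has `cvar` as computation part, so both composites compute to `cvar` there.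
  μ-assoc τ₁ τ₂ τ₃ (τ , just _)  = 𝒱.pentagon τ₁ τ₂ τ₃ τ , ≈-refl

  μ-unit : ∀ τ c → ((x₀ ·ʰ η c) ∘ʰ μ τ 𝟙 c) ≈ʰ (𝒱.r τ ·ʰ idʰ)
  μ-unit τ (τ′ , nothing) = pure (𝒱.triangle τ τ′)
  μ-unit τ (τ′ , just _)  = 𝒱.triangle τ τ′ , ≈-refl

  𝒞-isActegory : IsActegory 𝒞-action
  𝒞-isActegory = record
    { isCategory    = 𝒞-isCategory
    ; act-isFunctor = act-isFunctor
    ; η-natural     = η-natural
    ; μ-natural     = μ-natural
    ; η-isIso       = λ (τ , _) → retag-isIso (𝒱.l-isIso τ)
    ; μ-isIso       = λ τ₁ τ₂ (τ , _) → retag-isIso (𝒱.α-isIso τ₁ τ₂ τ)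
    ; μ-assoc       = μ-assoc
    ; μ-unit        = μ-unit
    }

  -- The strong equivariant functor from values to computations.

  F-isStrongEquivariant : IsStrongEquivariant (selfAction 𝒱-monoidal) 𝒞-action F
  F-isStrongEquivariant = record
    { isFunctor = record
      { F-resp-≈     = pure
      ; identity     = ≈ʰ-refl
      ; homomorphism = λ _ _ → ≈ʰ-refl
      }
    ; φ-natural = λ f g →
        ≈ʰ-trans (∘ʰ-identityˡ _) (≈ʰ-sym (∘ʰ-identityʳ (pure (f 𝒱.⊗₁ g))))
    ; φ-isIso   = λ _ _ → record
      { inverse = idʰ ; isoˡ = ≈ʰ-refl ; isoʳ = ≈ʰ-refl }
    -- On objects with empty computation part `μ` is by definition `pure` of the associator, and
    -- every `φ` is an identity. Only identity laws remain, with `·-identity` collapsing the action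
    -- on `φ`.
    ; φ-μ       = λ τ τ′ τ″ →
        ≈ʰ-trans (∘ʰ-identityʳ (pure (𝒱.α τ τ′ τ″)))
          (≈ʰ-sym (≈ʰ-trans (∘ʰ-identityˡ _)
            (≈ʰ-trans (∘ʰ-resp-≈ ·-identity ≈ʰ-refl) (∘ʰ-identityˡ _))))
    ; φ-η       = λ τ → ∘ʰ-identityʳ (pure (𝒱.l τ))
    }

theorem11 : ∀ {ℓ : Level} (𝓣 : Theory ℓ) →
    let open TermModel 𝓣 in
    IsCartesianCategory 𝒱-products
    × IsMonoidalCategory 𝒱-monoidal
    × IsActegory 𝒞-action
    × IsActegory (selfAction 𝒱-monoidal)
    × IsStrongEquivariant (selfAction 𝒱-monoidal) 𝒞-action F
theorem11 𝓣 =
    𝒱-isCartesian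
  , 𝒱-isMonoidal
  , 𝒞-isActegory
  , selfAction-isActegory 𝒱-isMonoidal
  , F-isStrongEquivariant
  where open TermModelProperties 𝓣
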